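{- Let $t, k, g$ be integers such that $t, g > k \geq 2$. Then there is a (large enough) integer $q$ and a set $\Pi = \{\pi_1, \pi_2, \ldots, \pi_t\}$ of $t$ permutations in $S_{m_q}$, where $m_q = (k-1)^q (t-1)^{q-1}$, such that the graph $G(t,k,q,\Pi)$ has no cycles of length $h$ for any $k < h < g$.
   Context: All graphs are finite and simple; $[m]=\{1,\dots,m\}$ and $S_m$ is the group of all permutations of $[m]$. For graphs $G,H$ and $S\subseteq V(G)$, $G\vee_S H$ denotes the graph obtained from a copy of $G$ and $|S|$ disjoint copies $H_v$ ($v\in S$) of $H$ by joining each vertex $v\in S$ to every vertex of $H_v$. Construction of $G(t,k,q,\Pi)$, for integers $t,k,q\ge 2$, $m_i=(k-1)^i(t-1)^{i-1}$ ($i\ge1$), and $\Pi=\{\pi_1,\dots,\pi_t\}\subseteq S_{m_q}$: (i) Let $G_1\cong K_k$, let $x\in V(G_1)$ be a vertex called the root, and let $W_1=V(G_1)\setminus\{x\}$, whose vertices are labelled $\binom{1}{\ell}$, $\ell\in[k-1]$. (ii) Recursively for $i\ge2$, let $G_i=G_{i-1}\vee_{W_{i-1}}(t-1)K_{k-1}$, where $(t-1)K_{k-1}$ is the disjoint union of $t-1$ copies of $K_{k-1}$, and $V(G_i)=V(G_{i-1})\cup W_i$, where $W_i$ is the set of new vertices. The vertices of $W_i$ are labelled by $2\times i$ matrices $\binom{u\; u_i}{v\; v_i}$ with $\binom{u}{v}\in W_{i-1}$, $u_i\in[t-1]$, $v_i\in[k-1]$, this label representing the $v_i$-th vertex in the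 $u_i$-th copy of $K_{k-1}$ attached to the vertex $\binom{u}{v}$. The set $W_i$ (level $i$) is linearly ordered lexicographically by columns, i.e. by the sequence $(u_1,v_1,u_2,v_2,\dots,u_i,v_i)$. One has $|W_i|=m_i$. (iii) Take $t$ disjoint copies $G_q^1,\dots,G_q^t$ of $G_q$ with roots $x_1,\dots,x_t$ and level-$q$ vertex sets $W_q^1,\dots,W_q^t$. Let $\varphi_j:W_q^j\to[m_q]$ be the order-preserving bijection. (iv) Identify all roots $x_1,\dots,x_t$ to a single vertex. (v) For every $j\in[m_q]$, identify the $t$ vertices $\varphi_i^{ -1}(\pi_i(j))$, $1\le i\le t$, to a single vertex. The resulting graph is $G(t,k,q,\Pi)$. -}

module Defs where

open import Data.Empty using (⊥-elim)
open import Data.Fin using (Fin; zero; suc; toℕ; combine; cast; _<_)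
import Data.Fin.Properties as Fin
open import Data.Fin.Permutation using (Permutation′; _⟨$⟩ʳ_)
open import Data.Nat as ℕ using (ℕ; zero; suc; _+_; _*_; _∸_; _^_)
import Data.Nat.Properties as ℕ
open import Data.Nat.Solver using (module +-*-Solver)
open import Data.Product using (∃; _×_; _,_; proj₁; proj₂)
open import Data.Product.Function.NonDependent.Setoid using (_×-surjection_)
open import Data.Product.Relation.Binary.Lex.Strict using (×-Lex)
open import Data.Product.Relation.Binary.Pointwise.NonDependent
  using (_×ₛ_; ≡⇒≡×≡)
open import Data.Sum using (_⊎_; inj₁; inj₂)
open import Data.Sum.Function.Setoid using (_⊎-surjection_)
open import Data.Sum.Relation.Binary.Pointwise using (_⊎ₛ_; inj₁; inj₂)
open import Function.Bundles using (Surjection; Injection)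
open import Function.Construct.Composition using (surjection)
import Function.Construct.Identity as Identity
open import Function.Definitions using (Injective)
open import Function.Properties.Inverse using (↔⇒↠; ↔⇒↣)
open import Level using (0ℓ)
open import Relation.Binary using (Rel; Setoid; Symmetric; Irreflexive; IsEquivalence;
  _⇒_; _Respects₂_; tri<; tri≈; tri>)
open import Relation.Binary.Morphism.Structures using (IsOrderIsomorphism)
open import Relation.Binary.PropositionalEquality
  using (_≡_; _≢_; refl; sym; trans; cong; subst₂; setoid)
open import Relation.Nullary using (¬_)

------------------------------------------------------------------------
-- Finite simple graphs

Finite : Setoid 0ℓ 0ℓ → Set
Finite S = ∃ λ n → Surjection (setoid (Fin n)) S

-- The vertices form a setoid so that identifying vertices amounts to
-- coarsening the equality.

record Graph : Set₁ where
  field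
    vertices : Setoid 0ℓ 0ℓ
    finite   : Finite vertices

  open Setoid vertices public using (_≈_) renaming (Carrier to Vertex)
  module ≈ = Setoid vertices

  field
    Adj        : Rel Vertex 0ℓ
    Adj-resp   : Adj Respects₂ _≈_
    Adj-sym    : Symmetric Adj
    Adj-irrefl : Irreflexive _≈_ Adj

open Graph using (Vertex; vertices)

record Cycle (G : Graph) (h : ℕ) : Set where
  open Graph G using (_≈_; Adj)
  field
    3≤h       : 3 ℕ.≤ h
    vertex    : Fin h → Vertex G
    injective : Injective _≡_ _≈_ vertex
    step      : ∀ i j → toℕ j ≡ suc (toℕ i) → Adj (vertex i) (vertex j)
    close     : ∀ i j → suc (toℕ i) ≡ h → toℕ j ≡ 0 → Adj (vertex i) (vertex j)

------------------------------------------------------------------------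
-- Operations on graphs

K : ℕ → Graph
K n = record
  { vertices   = setoid (Fin n)
  ; finite     = n , Identity.surjection (setoid (Fin n))
  ; Adj        = _≢_
  ; Adj-resp   = (λ { refl p → p }) , (λ { refl p → p })
  ; Adj-sym    = λ p q → p (sym q)
  ; Adj-irrefl = λ p q → q p
  }

private
  finite-⊎ : ∀ {S T} → Finite S → Finite T → Finite (S ⊎ₛ T)
  finite-⊎ {S} {T} (m , f) (n , g) = m + n ,
    surjection (↔⇒↠ (Fin.+↔⊎ {m} {n})) (surjection split (f ⊎-surjection g))
    where
    split : Surjection (setoid (Fin m ⊎ Fin n)) (setoid (Fin m) ⊎ₛ setoid (Fin n))
    split = record
      { to = λ x → x
      ; cong = λ { {inj₁ _} refl → inj₁ refl ; {inj₂ _} refl → inj₂ refl }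
      ; surjective = λ y → y , λ { {inj₁ _} refl → inj₁ refl ; {inj₂ _} refl → inj₂ refl }
      }

  finite-× : ∀ {S T} → Finite S → Finite T → Finite (S ×ₛ T)
  finite-× {S} {T} (m , f) (n , g) = m * n ,
    surjection (↔⇒↠ (Fin.*↔× {m} {n})) (surjection split (f ×-surjection g))
    where
    split : Surjection (setoid (Fin m × Fin n)) (setoid (Fin m) ×ₛ setoid (Fin n))
    split = record
      { to = λ x → x
      ; cong = ≡⇒≡×≡
      ; surjective = λ y → y , ≡⇒≡×≡
      }

-- n disjoint copies of G.

_∙_ : ℕ → Graph → Graph
n ∙ G = record
  { vertices   = setoid (Fin n) ×ₛ vertices G
  ; finite     = finite-× (n , Identity.surjection (setoid (Fin n))) G.finite
  ; Adj        = λ { (i , x) (j , y) → i ≡ j × G.Adj x y }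
  ; Adj-resp   = (λ { (refl , q) (r , a) → r , proj₁ G.Adj-resp q a })
               , (λ { (refl , q) (r , a) → r , proj₂ G.Adj-resp q a })
  ; Adj-sym    = λ { (r , a) → sym r , G.Adj-sym a }
  ; Adj-irrefl = λ { (_ , q) (_ , a) → G.Adj-irrefl q a }
  }
  where module G = Graph G

-- join is the graph G ∨_S H, the subset S of the vertices of G being given by an
-- embedding ι.

module _ (G : Graph) {S : Setoid 0ℓ 0ℓ} (S-finite : Finite S)
         (ι : Injection S (vertices G)) (H : Graph) where
  private
    module G = Graph G
    module H = Graph H
    module S = Setoid S
    module ι = Injection ι

    V : Setoid 0ℓ 0ℓ
    V = vertices G ⊎ₛ (S ×ₛ vertices H)

  ∨-Adj : Rel (Setoid.Carrier V) 0ℓ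
  ∨-Adj (inj₁ x)       (inj₁ y)       = G.Adj x y
  ∨-Adj (inj₁ x)       (inj₂ (s , _)) = x G.≈ ι.to s
  ∨-Adj (inj₂ (s , _)) (inj₁ y)       = y G.≈ ι.to s
  ∨-Adj (inj₂ (s , x)) (inj₂ (r , y)) = s S.≈ r × H.Adj x y

  private
    ∨-sym : Symmetric ∨-Adj
    ∨-sym {inj₁ x} {inj₁ y} a = G.Adj-sym a
    ∨-sym {inj₁ x} {inj₂ y} a = a
    ∨-sym {inj₂ x} {inj₁ y} a = a
    ∨-sym {inj₂ x} {inj₂ y} (e , a) = S.sym e , H.Adj-sym a

    ∨-respʳ : ∀ {x y z} → Setoid._≈_ V y z → ∨-Adj x y → ∨-Adj x z
    ∨-respʳ {inj₁ _} (inj₁ e)       a       = proj₁ G.Adj-resp e a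
    ∨-respʳ {inj₂ _} (inj₁ e)       a       = G.≈.trans (G.≈.sym e) a
    ∨-respʳ {inj₁ _} (inj₂ (e , _)) a       = G.≈.trans a (ι.cong e)
    ∨-respʳ {inj₂ _} (inj₂ (e , f)) (r , a) = S.trans r e , proj₁ H.Adj-resp f a

    ∨-irrefl : Irreflexive (Setoid._≈_ V) ∨-Adj
    ∨-irrefl (inj₁ e)       a       = G.Adj-irrefl e a
    ∨-irrefl (inj₂ (_ , e)) (_ , a) = H.Adj-irrefl e a

  join : Graph
  join = record
    { vertices   = V
    ; finite     = finite-⊎ G.finite (finite-× S-finite H.finite)
    ; Adj        = ∨-Adj
    ; Adj-resp   = (λ {x} {y} {z} → ∨-respʳ {x} {y} {z})
                 , (λ {x} {y} {z} e a →
                     ∨-sym {x} {z} (∨-respʳ {x} {y} {z} e (∨-sym {y} {x} a)))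
    ; Adj-sym    = λ {x} {y} → ∨-sym {x} {y}
    ; Adj-irrefl = ∨-irrefl
    }

-- The graph obtained from G by identifying ∼-related vertices.

identify : (G : Graph) (_∼_ : Rel (Vertex G) 0ℓ) → IsEquivalence _∼_ →
           Graph._≈_ G ⇒ _∼_ → Irreflexive _∼_ (Graph.Adj G) → Graph
identify G _∼_ ∼-equiv ≈⇒∼ loopless = record
  { vertices   = record { isEquivalence = ∼-equiv }
  ; finite     = proj₁ G.finite , record
      { to         = e.to
      ; cong       = λ p → ≈⇒∼ (e.cong p)
      ; surjective = λ y → proj₁ (e.surjective y) , λ p → ≈⇒∼ (proj₂ (e.surjective y) p)
      }
  ; Adj        = λ x y → ∃ λ x′ → ∃ λ y′ → x ∼ x′ × y ∼ y′ × G.Adj x′ y′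
  ; Adj-resp   = (λ { p (x′ , y′ , q , r , a) → x′ , y′ , q , E.trans (E.sym p) r , a })
               , (λ { p (x′ , y′ , q , r , a) → x′ , y′ , E.trans (E.sym p) q , r , a })
  ; Adj-sym    = λ { (x′ , y′ , q , r , a) → y′ , x′ , r , q , G.Adj-sym a }
  ; Adj-irrefl = λ { p (x′ , y′ , q , r , a) →
                     loopless (E.trans (E.sym q) (E.trans p r)) a }
  }
  where
  module G = Graph G
  module E = IsEquivalence ∼-equiv
  module e = Surjection (proj₂ G.finite)

------------------------------------------------------------------------
-- The construction

m : (t k i : ℕ) → ℕ
m t k i = (k ∸ 1) ^ i * (t ∸ 1) ^ (i ∸ 1)

module Tower (t k : ℕ) where

  -- Throughout this module indices are shifted: W n, tower n, … stand for
  -- W_{n+1}, G_{n+1}, ….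

  -- The labels, with the matrix grouped by columns. The entry u₁ = 1 of the
  -- first column is omitted.

  W : ℕ → Set
  W zero    = Fin (k ∸ 1)
  W (suc n) = W n × (Fin (t ∸ 1) × Fin (k ∸ 1))

  Lex : ∀ n → Rel (W n) 0ℓ
  Lex zero    = _<_
  Lex (suc n) = ×-Lex _≡_ (Lex n) (×-Lex _≡_ _<_ _<_)

  private
    m-zero : k ∸ 1 ≡ m t k 1
    m-zero = solve 1 (λ b → b := b :^ 1 :* con 1) refl (k ∸ 1)
      where
      open +-*-Solver

    m-suc : ∀ n → m t k (suc n) * ((t ∸ 1) * (k ∸ 1)) ≡ m t k (suc (suc n))
    m-suc n = solve 4 (λ p b q a → p :* q :* (a :* b) := b :* p :* (a :* q)) refl
                ((k ∸ 1) ^ suc n) (k ∸ 1) ((t ∸ 1) ^ n) (t ∸ 1)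
      where
      open +-*-Solver

  φ : ∀ n → W n → Fin (m t k (suc n))
  φ zero    v             = cast m-zero v
  φ (suc n) (w , (u , v)) = cast (m-suc n) (combine (φ n w) (combine u v))

  private
    cast-< : ∀ {a b} (e : a ≡ b) {i j : Fin a} → i < j → cast e i < cast e j
    cast-< refl {i} {j} = subst₂ _<_ (sym (Fin.cast-is-id refl i)) (sym (Fin.cast-is-id refl j))

    cast-<⁻ : ∀ {a b} (e : a ≡ b) {i j : Fin a} → cast e i < cast e j → i < j
    cast-<⁻ refl {i} {j} = subst₂ _<_ (Fin.cast-is-id refl i) (Fin.cast-is-id refl j)

    cast-inj : ∀ {a b} (e : a ≡ b) {i j : Fin a} → cast e i ≡ cast e j → i ≡ j
    cast-inj refl {i} {j} = subst₂ _≡_ (Fin.cast-is-id refl i) (Fin.cast-is-id refl j)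

    combine-< : ∀ {a b} {i j : Fin a} {x y : Fin b} →
                ×-Lex _≡_ _<_ _<_ (i , x) (j , y) → combine i x < combine j y
    combine-< {x = x} {y} (inj₁ i<j) = Fin.combine-monoˡ-< x y i<j
    combine-< {b = b} {i} {x = x} {y} (inj₂ (refl , x<y)) =
      subst₂ ℕ._<_ (sym (Fin.toℕ-combine i x)) (sym (Fin.toℕ-combine i y))
        (ℕ.+-monoʳ-< (b * toℕ i) x<y)

    combine-<⁻ : ∀ {a b} {i j : Fin a} {x y : Fin b} →
                 combine i x < combine j y → ×-Lex _≡_ _<_ _<_ (i , x) (j , y)
    combine-<⁻ {b = b} {i} {j} {x} {y} p with Fin.<-cmp i j
    ... | tri< i<j _ _ = inj₁ i<j
    ... | tri> _ _ j<i = ⊥-elim (Fin.<-asym p (Fin.combine-monoˡ-< y x j<i))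
    ... | tri≈ _ refl _ = inj₂ (refl , ℕ.+-cancelˡ-< (b * toℕ i) (toℕ x) (toℕ y)
            (subst₂ ℕ._<_ (Fin.toℕ-combine i x) (Fin.toℕ-combine i y) p))

    φ-inj : ∀ n {x y : W n} → φ n x ≡ φ n y → x ≡ y
    φ-inj zero e = cast-inj m-zero e
    φ-inj (suc n) {w , (u , v)} {w′ , (u′ , v′)} e
      with p , q ← Fin.combine-injective (φ n w) (combine u v) (φ n w′) (combine u′ v′)
                     (cast-inj (m-suc n) e)
      with refl ← φ-inj n p
      with refl , refl ← Fin.combine-injective u v u′ v′ q = refl

    φ-< : ∀ n {x y : W n} → Lex n x y → φ n x < φ n y
    φ-< zero p = cast-< m-zero p
    φ-< (suc n) (inj₁ p) = cast-< (m-suc n) (combine-< (inj₁ (φ-< n p)))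
    φ-< (suc n) {w , _} (inj₂ (refl , p)) =
      cast-< (m-suc n) (combine-< {i = φ n w} (inj₂ (refl , combine-< p)))

    φ-<⁻ : ∀ n {x y : W n} → φ n x < φ n y → Lex n x y
    φ-<⁻ zero p = cast-<⁻ m-zero p
    φ-<⁻ (suc n) p with combine-<⁻ (cast-<⁻ (m-suc n) p)
    ... | inj₁ q       = inj₁ (φ-<⁻ n q)
    ... | inj₂ (e , q) = inj₂ (φ-inj n e , combine-<⁻ q)

    φ-surj : ∀ n (j : Fin (m t k (suc n))) → ∃ λ w → φ n w ≡ j
    φ-surj zero j = cast (sym m-zero) j , Fin.cast-involutive m-zero (sym m-zero) j
    φ-surj (suc n) j
      with a , b , e ← Fin.combine-surjective {m t k (suc n)} (cast (sym (m-suc n)) j)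
      with w , refl ← φ-surj n a
      with u , v , refl ← Fin.combine-surjective {t ∸ 1} b
      = (w , (u , v)) , trans (cong (cast (m-suc n)) e)
                              (Fin.cast-involutive (m-suc n) (sym (m-suc n)) j)

  -- This determines φ n uniquely.

  φ-isOrderIsomorphism : ∀ n → IsOrderIsomorphism _≡_ _≡_ (Lex n) _<_ (φ n)
  φ-isOrderIsomorphism n = record
    { isOrderMonomorphism = record
      { isOrderHomomorphism = record { cong = cong (φ n) ; mono = φ-< n }
      ; injective = φ-inj n
      ; cancel    = φ-<⁻ n
      }
    ; surjective = λ j → proj₁ (φ-surj n j) , λ { refl → proj₂ (φ-surj n j) }
    }

  W-finite : ∀ n → Finite (setoid (W n))
  W-finite n = m t k (suc n) , record
    { to         = λ j → proj₁ (φ-surj n j)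
    ; cong       = cong (λ j → proj₁ (φ-surj n j))
    ; surjective = λ w → φ n w , λ { refl → φ-inj n (proj₂ (φ-surj n (φ n w))) }
    }

  -- level n embeds W n as the set of the vertices added last. For k ≥ 1,
  -- K (suc (k ∸ 1)) is the complete graph on k vertices.

  mutual
    tower : ℕ → Graph
    tower zero    = K (suc (k ∸ 1))
    tower (suc n) = join (tower n) (W-finite n) (level n) ((t ∸ 1) ∙ K (k ∸ 1))

    level : ∀ n → Injection (setoid (W n)) (vertices (tower n))
    level zero    = record { to = suc ; cong = cong suc ; injective = Fin.suc-injective }
    level (suc n) = record
      { to        = inj₂
      ; cong      = λ { refl → inj₂ (refl , (refl , refl)) }
      ; injective = λ { (inj₂ (refl , (refl , refl))) → refl }
      }

  root : ∀ n → Vertex (tower n)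
  root zero    = zero
  root (suc n) = inj₁ (root n)

  leaf : ∀ n → W n → Vertex (tower n)
  leaf n = Injection.to (level n)

  module Gluing (n : ℕ) (Π : Fin t → Permutation′ (m t k (suc n))) where

    private
      module T = Graph (tower n)
      module U = Graph (t ∙ tower n)

    -- Here φ n w ≡ Π i ⟨$⟩ʳ j says that w = φ⁻¹(π_i(j)).

    data _∼_ : Rel (Vertex (t ∙ tower n)) 0ℓ where
      same   : ∀ {x y} → x U.≈ y → x ∼ y
      roots  : ∀ {i i′ x x′} → x T.≈ root n → x′ T.≈ root n → (i , x) ∼ (i′ , x′)
      leaves : ∀ {i i′ x x′ w w′} (j : Fin (m t k (suc n))) →
               x  T.≈ leaf n w  → φ n w  ≡ Π i  ⟨$⟩ʳ j →
               x′ T.≈ leaf n w′ → φ n w′ ≡ Π i′ ⟨$⟩ʳ j →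
               (i , x) ∼ (i′ , x′)

    private
      root≉leaf : ∀ n {w} → ¬ (Graph._≈_ (tower n) (root n) (leaf n w))
      root≉leaf zero    ()
      root≉leaf (suc n) ()

      ∼-sym : ∀ {x y} → x ∼ y → y ∼ x
      ∼-sym (same {x} {y} e)   = same (U.≈.sym {x} {y} e)
      ∼-sym (roots p q)        = roots q p
      ∼-sym (leaves j p q r s) = leaves j r s p q

      ∼-trans : ∀ {x y z} → x ∼ y → y ∼ z → x ∼ z
      ∼-trans (same {x} {y} e) (same {_} {z} f) = same (U.≈.trans {x} {y} {z} e f)
      ∼-trans (same (refl , e)) (roots p q) = roots (T.≈.trans e p) q
      ∼-trans (same (refl , e)) (leaves j p q r s) = leaves j (T.≈.trans e p) q r s
      ∼-trans (roots p q) (same (refl , e)) = roots p (T.≈.trans (T.≈.sym e) q)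
      ∼-trans (roots p _) (roots _ q) = roots p q
      ∼-trans (roots _ p) (leaves _ q _ _ _) =
        ⊥-elim (root≉leaf n (T.≈.trans (T.≈.sym p) q))
      ∼-trans (leaves j p q r s) (same (refl , e)) =
        leaves j p q (T.≈.trans (T.≈.sym e) r) s
      ∼-trans (leaves _ _ _ p _) (roots q _) =
        ⊥-elim (root≉leaf n (T.≈.trans (T.≈.sym q) p))
      ∼-trans (leaves {i′ = i} j p q r s) (leaves j′ p′ q′ r′ s′)
        with refl ← Injection.injective (level n) (T.≈.trans (T.≈.sym r) p′)
        with refl ← Injection.injective (↔⇒↣ (Π i)) (trans (sym s) q′) = leaves j p q r′ s′

      ∼⇒≈ : ∀ {i x y} → (i , x) ∼ (i , y) → x T.≈ y
      ∼⇒≈ (same (_ , e)) = e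
      ∼⇒≈ (roots p q)    = T.≈.trans p (T.≈.sym q)
      ∼⇒≈ (leaves j p q r s) with refl ← φ-inj n (trans q (sym s)) =
        T.≈.trans p (T.≈.sym r)

    ∼-isEquivalence : IsEquivalence _∼_
    ∼-isEquivalence = record
      { refl  = λ {x} → same (U.≈.refl {x})
      ; sym   = ∼-sym
      ; trans = ∼-trans
      }

    ∼-loopless : Irreflexive _∼_ U.Adj
    ∼-loopless p (refl , a) = T.Adj-irrefl (∼⇒≈ p) a

    glued : Graph
    glued = identify (t ∙ tower n) _∼_ ∼-isEquivalence same ∼-loopless

G : (t k q : ℕ) → 2 ℕ.≤ q → (Fin t → Permutation′ (m t k q)) → Graph
G t k (suc n) _ Π = Tower.Gluing.glued t k n Π

{-# OPTIONS --safe #-}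
module Submission where

-- Call two leaf positions of a tower equivalent when they have the same
-- ancestor s levels up, where s exceeds the length of the cycles to be avoided.
-- A short cycle of the glued graph that is not confined to one tower contains a
-- leaf at which it changes tower, and stays too low to leave the blocks of this
-- equivalence. It therefore yields a closed walk on positions in which
-- consecutive steps stay in blocks of distinct towers; a cycle confined to one
-- tower lies in a clique, as the tower is a tree of cliques.
--
-- Permutations without short closed walks are obtained by repeated covers: a
-- block structure is lifted by attaching to each incidence of a position with a
-- tower a coordinate, on which that incidence acts by a derangement. A closed
-- walk must undo each of its coordinate changes, so that the minimal length of
-- closed walks grows in each cover. The coordinates range over the columns of
-- the labels, so that a cover is again a tower, only higher.

open import Defs
open import Data.Nat using (ℕ; zero; suc; _+_; _*_; _∸_; _≤_; _<_; s≤s; z≤n; pred; _%_; NonZero)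
open import Data.Nat.DivMod
  using (_mod_; m%n<n; m<n⇒m%n≡m; n%n≡0; %-distribˡ-+; m%n%n≡m%n; [m+n]%n≡m%n; [m+kn]%n≡m%n)
import Data.Nat.Properties as ℕ
open import Data.Fin using (Fin; zero; suc; combine; fromℕ; inject₁; toℕ)
open import Data.Fin.Permutation using (Permutation′; _≈_; _⟨$⟩ʳ_)
import Data.Fin.Properties as Fin
open import Data.Fin.Relation.Unary.Top using (view; ‵fromℕ; ‵inject₁; view-fromℕ; view-inject₁)
open import Data.Maybe using (Maybe; just; nothing)
open import Data.Maybe.Properties using (just-injective)
open import Data.Product using (∃; Σ-syntax; ∃-syntax; _×_; _,_; proj₁; proj₂)
open import Data.Product.Function.NonDependent.Propositional using (_×-↔_)
open import Data.Product.Properties using (≡-dec; ,-injective)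
open import Data.Sum using (_⊎_; inj₁; inj₂)
open import Data.Sum.Relation.Binary.Pointwise using (inj₁; inj₂)
open import Data.Vec using (Vec; []; _∷_; lookup; updateAt)
import Data.Vec.Properties as Vec
open import Function.Bundles using (_↔_; module Inverse; mk↔ₛ′; mk⤖)
open import Function.Construct.Composition using (_↔-∘_)
open import Function.Construct.Identity using (↔-id)
open import Function.Definitions using (Injective)
open import Function.Properties.Bijection using (⤖⇒↔)
open import Function.Properties.Inverse using (↔-sym)
open import Relation.Binary using (DecidableEquality; IsEquivalence; tri<; tri≈; tri>)
open import Relation.Binary.Morphism.Structures using (IsOrderIsomorphism)
open import Relation.Binary.PropositionalEquality
  using (_≡_; _≢_; refl; sym; trans; cong; cong₂; subst; subst₂; ≢-sym; module ≡-Reasoning)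
open import Relation.Nullary using (¬_; Dec; yes; no; contradiction)

-- Closed walks and covers of block structures

module _ {A : Set} (ρ : A ↔ A) {n : ℕ} where
  open Inverse ρ

  updateAt-injective : ∀ (x : Fin n) {v w : Vec A n} →
                       updateAt v x to ≡ updateAt w x to → v ≡ w
  updateAt-injective x {v} {w} e =
    trans (sym (undo v)) (trans (cong (λ u → updateAt u x from) e) (undo w))
    where
    undo : ∀ u → updateAt (updateAt u x to) x from ≡ u
    undo u = trans (Vec.updateAt-updateAt x u)
                   (Vec.updateAt-id-local x u (strictlyInverseʳ _))

module _ {I P Q : Set} (c : I → P → Q) where

  -- Here `P` stands for positions, `I` for towers, and `c i p` is the block of tower `i` containing
  -- `p`. The tower of the last step is an index so that `snoc` can demand a change of tower.
  data Walk (p : P) : ℕ → I → P → Set where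
    first : ∀ {i q} → p ≢ q → c i p ≡ c i q → Walk p 1 i q
    snoc  : ∀ {l i j q r} → Walk p l i q → i ≢ j → q ≢ r → c j q ≡ c j r →
            Walk p (suc l) j r

  -- The first and last step of a closed walk may use the same tower: nothing is known about these
  -- towers for the closed subwalks cut out in `acyclic-cover`.
  Acyclic : ℕ → Set
  Acyclic L = ∀ {p l i} → l ≤ L → ¬ Walk p l i p

-- `x p i` is the coordinate of the incidence of `p` with tower `i`. By `c̃⇒α`, a step from `p` to
-- `q` in a block of tower `i`, with distinct projections, applies `ρ` at the coordinate of `π p`,
-- the inverse of `ρ` at that of `π q`, and fixes all others.
module Cover
  {I P Q P̃ Q̃ A : Set} {c : I → P → Q} {c̃ : I → P̃ → Q̃}
  (_≟ᴾ_ : DecidableEquality P)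
  {E : ℕ} (x : P → I → Fin E)
  (x-injective : ∀ {p q i j} → x p i ≡ x q j → p ≡ q × i ≡ j)
  (ρ : A ↔ A) (ρ-free : ∀ a → Inverse.to ρ a ≢ a)
  (π : P̃ → P) (α : P̃ → Vec A E)
  (πα-injective : ∀ {p q} → π p ≡ π q → α p ≡ α q → p ≡ q)
  (c̃⇒c : ∀ {i p q} → c̃ i p ≡ c̃ i q → c i (π p) ≡ c i (π q))
  (c̃⇒α : ∀ {i p q} → c̃ i p ≡ c̃ i q →
          updateAt (α p) (x (π p) i) (Inverse.to ρ) ≡
          updateAt (α q) (x (π q) i) (Inverse.to ρ))
  where
  open Inverse ρ using (to)

  -- Two lifts of one position in one block update the same coordinate, and the update is injective.
  -- Hence projected walks never stall.
  π-≢ : ∀ {i p q} → p ≢ q → c̃ i p ≡ c̃ i q → π p ≢ π q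
  π-≢ {i} {p} {q} p≢q e πp≡πq = p≢q (πα-injective πp≡πq
    (updateAt-injective ρ _ (trans (c̃⇒α e)
      (cong (λ z → updateAt (α q) (x z i) to) (sym πp≡πq)))))

  x-≢ : ∀ {p q i j} → p ≢ q → x p i ≢ x q j
  x-≢ p≢q e = p≢q (proj₁ (x-injective e))

  α-step : ∀ {i p q y} → c̃ i p ≡ c̃ i q → y ≢ x (π p) i → y ≢ x (π q) i →
           lookup (α p) y ≡ lookup (α q) y
  α-step {i} {p} {q} {y} e ≢p ≢q = begin
    lookup (α p) y                              ≡⟨ Vec.lookup∘updateAt′ y _ ≢p (α p) ⟨
    lookup (updateAt (α p) (x (π p) i) to) y    ≡⟨ cong (λ v → lookup v y) (c̃⇒α e) ⟩
    lookup (updateAt (α q) (x (π q) i) to) y    ≡⟨ Vec.lookup∘updateAt′ y _ ≢q (α q) ⟩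
    lookup (α q) y                              ∎
    where open ≡-Reasoning

  -- `π q` has a different coordinate, so the value at `q` is `ρ` of the value at `p`, and `ρ` has
  -- no fixed points.
  α-jump : ∀ {i p q} → c̃ i p ≡ c̃ i q → π p ≢ π q →
           lookup (α p) (x (π p) i) ≢ lookup (α q) (x (π p) i)
  α-jump {i} {p} {q} e p≢q same = ρ-free (lookup (α p) (x (π p) i)) (begin
    to (lookup (α p) y)                         ≡⟨ Vec.lookup∘updateAt y (α p) ⟨
    lookup (updateAt (α p) y to) y              ≡⟨ cong (λ v → lookup v y) (c̃⇒α e) ⟩
    lookup (updateAt (α q) (x (π q) i) to) y    ≡⟨ Vec.lookup∘updateAt′ y _ (x-≢ p≢q) (α q) ⟩
    lookup (α q) y                              ≡⟨ same ⟨
    lookup (α p) y                              ∎)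
    where
    open ≡-Reasoning
    y = x (π p) i

  -- Unless the projection of a walk meets u, the walk fixes all coordinates
  -- belonging to u; otherwise the projection has a tail starting at u.
  fixed-or-tail : ∀ {p l i q} → Walk c̃ p l i q → ∀ u j →
    lookup (α p) (x u j) ≡ lookup (α q) (x u j) ⊎ u ≡ π q ⊎
    ∃[ l′ ] l′ ≤ l × Walk c u l′ i (π q)
  fixed-or-tail {p} {q = q} (first p≢q e) u j with u ≟ᴾ π p | u ≟ᴾ π q
  ... | _ | yes u≡q = inj₂ (inj₁ u≡q)
  ... | yes refl | no _ = inj₂ (inj₂ (1 , s≤s z≤n , first (π-≢ p≢q e) (c̃⇒c e)))
  ... | no u≢p | no u≢q = inj₁ (α-step e (x-≢ u≢p) (x-≢ u≢q))
  fixed-or-tail {q = r} (snoc {q = q} w i≢i′ q≢r e) u j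
    with fixed-or-tail w u j | u ≟ᴾ π q | u ≟ᴾ π r
  ... | _ | _ | yes u≡r = inj₂ (inj₁ u≡r)
  ... | _ | yes refl | no _ = inj₂ (inj₂ (1 , s≤s z≤n , first (π-≢ q≢r e) (c̃⇒c e)))
  ... | inj₁ f | no u≢q | no u≢r = inj₁ (trans f (α-step e (x-≢ u≢q) (x-≢ u≢r)))
  ... | inj₂ (inj₁ u≡q) | no u≢q | no _ = contradiction u≡q u≢q
  ... | inj₂ (inj₂ (l′ , l′≤l , w′)) | no _ | no _ =
    inj₂ (inj₂ (suc l′ , s≤s l′≤l , snoc w′ i≢i′ (π-≢ q≢r e) (c̃⇒c e)))

  -- The last step of a closed walk, from q along i, changes the coordinate
  -- (q , i), and the step before it does not. If an earlier step does, then the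
  -- projection passes through q twice, so contains a shorter closed walk.
  acyclic-cover : ∀ {L} → Acyclic c L → Acyclic c̃ (suc L)
  acyclic-cover acyclic l≤L (first p≢p _) = p≢p refl
  acyclic-cover acyclic l≤L (snoc {q = q} (first p≢q e) i≢j q≢p f) =
    α-jump f (π-≢ q≢p f)
      (sym (α-step e (x-≢ (π-≢ q≢p f)) (λ y≡ → i≢j (sym (proj₂ (x-injective y≡))))))
  acyclic-cover acyclic (s≤s l≤L) (snoc {j = j} {q = q} (snoc w i≢i′ r≢q e) i′≢j q≢p f)
    with fixed-or-tail w (π q) j
  ... | inj₂ (inj₁ q≡r) = π-≢ r≢q e (sym q≡r)
  ... | inj₂ (inj₂ (l′ , l′≤l , w′)) =
    acyclic (ℕ.≤-trans (s≤s l′≤l) l≤L) (snoc w′ i≢i′ (π-≢ r≢q e) (c̃⇒c e))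
  ... | inj₁ fixed = α-jump f (π-≢ q≢p f) (sym (trans fixed
    (α-step e (x-≢ (λ q≡r → π-≢ r≢q e (sym q≡r))) (λ y≡ → i′≢j (sym (proj₂ (x-injective y≡)))))))

-- Derangements and twisted permutations

↔-injective : ∀ {A B : Set} (f : A ↔ B) {x y} → Inverse.to f x ≡ Inverse.to f y → x ≡ y
↔-injective f e = trans (sym (strictlyInverseʳ _)) (trans (cong from e) (strictlyInverseʳ _))
  where open Inverse f

rotate : ∀ {n} → Fin (suc n) ↔ Fin (suc n)
rotate {n} = mk↔ₛ′ to from to∘from from∘to
  where
  to : ∀ {n} → Fin (suc n) → Fin (suc n)
  to zero    = fromℕ _
  to (suc i) = inject₁ i
  from : Fin (suc n) → Fin (suc n)
  from i with view i
  ... | ‵fromℕ     = zero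
  ... | ‵inject₁ j = suc j
  to∘from : ∀ i → to (from i) ≡ i
  to∘from i with view i
  ... | ‵fromℕ     = refl
  ... | ‵inject₁ j = refl
  from∘to : ∀ i → from (to i) ≡ i
  from∘to zero    rewrite view-fromℕ n    = refl
  from∘to (suc i) rewrite view-inject₁ i = refl

rotate-free : ∀ {n} (i : Fin (suc (suc n))) → Inverse.to rotate i ≢ i
rotate-free zero    ()
rotate-free (suc i) e = ℕ.1+n≢n (trans (cong toℕ (sym e)) (Fin.toℕ-inject₁ i))

module _ {I A P : Set} {E : ℕ} (x : P → I → Fin E) (ρ : A ↔ A) (σ : I → P ↔ P) where

  -- The coordinate is selected by the position before `σ i` acts, so the inverse looks it up at
  -- `S.from p`.
  twist : I → (P × Vec A E) ↔ (P × Vec A E)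
  twist i = mk↔ₛ′
    (λ (p , v) → S.to p , updateAt v (x p i) R.to)
    (λ (p , v) → S.from p , updateAt v (x (S.from p) i) R.from)
    (λ (p , v) → cong₂ _,_ (S.strictlyInverseˡ p)
      (trans (Vec.updateAt-updateAt _ v) (Vec.updateAt-id-local _ v (R.strictlyInverseˡ _))))
    (λ (p , v) → cong₂ _,_ (S.strictlyInverseʳ p)
      (trans (cong (λ q → updateAt (updateAt v (x p i) R.to) (x q i) R.from) (S.strictlyInverseʳ p))
        (trans (Vec.updateAt-updateAt _ v) (Vec.updateAt-id-local _ v (R.strictlyInverseʳ _)))))
    where
    module R = Inverse ρ
    module S = Inverse (σ i)

-- Block structures on the labels of a tower

module Blocks (t k : ℕ) where
  open Tower t k

  Column : Set
  Column = Fin (t ∸ 1) × Fin (k ∸ 1)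

  ancestor : ∀ s {r} → W (s + r) → W r
  ancestor zero    w       = w
  ancestor (suc s) (w , _) = ancestor s w

  -- insert s E inserts E columns before the last s columns.

  extract : ∀ s E {r} → W (s + (E + r)) → W (s + r) × Vec Column E
  extract zero    zero    w       = w , []
  extract zero    (suc E) (w , c) = let w′ , v = extract zero E w in w′ , c ∷ v
  extract (suc s) E       (w , c) = let w′ , v = extract s E w in (w′ , c) , v

  insert : ∀ s E {r} → W (s + r) × Vec Column E → W (s + (E + r))
  insert zero    zero    (w , [])       = w
  insert zero    (suc E) (w , (c ∷ v))  = insert zero E (w , v) , c
  insert (suc s) E       ((w , c) , v)  = insert s E (w , v) , c

  extract-insert : ∀ s E {r} (y : W (s + r) × Vec Column E) → extract s E (insert s E y) ≡ y
  extract-insert zero    zero    (w , [])      = refl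
  extract-insert zero    (suc E) (w , (c ∷ v)) =
    cong (λ (w , v) → w , c ∷ v) (extract-insert zero E (w , v))
  extract-insert (suc s) E       ((w , c) , v) =
    cong (λ (w , v) → (w , c) , v) (extract-insert s E (w , v))

  insert-extract : ∀ s E {r} (w : W (s + (E + r))) → insert s E (extract s E w) ≡ w
  insert-extract zero    zero    w       = refl
  insert-extract zero    (suc E) (w , c) = cong (_, c) (insert-extract zero E w)
  insert-extract (suc s) E       (w , c) = cong (_, c) (insert-extract s E w)

  insertion : ∀ s E {r} → (W (s + r) × Vec Column E) ↔ W (s + (E + r))
  insertion s E = mk↔ₛ′ (insert s E) (extract s E) (insert-extract s E) (extract-insert s E)

  -- The inserted columns lie above the last `s`, so passing to the ancestor keeps them all: a block
  -- of the cover determines the whole coordinate vector.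
  extract-ancestor : ∀ s E {r} (w : W (s + (E + r))) →
    extract zero E (ancestor s w) ≡
    (ancestor s (proj₁ (extract s E w)) , proj₂ (extract s E w))
  extract-ancestor zero    E w       = refl
  extract-ancestor (suc s) E (w , _) = extract-ancestor s E w

  positions : ∀ n → W n ↔ Fin (m t k (suc n))
  positions n = ⤖⇒↔ (mk⤖ (injective , surjective))
    where open IsOrderIsomorphism (φ-isOrderIsomorphism n)

  _≟ᵂ_ : ∀ {n} → DecidableEquality (W n)
  _≟ᵂ_ {zero}  = Fin._≟_
  _≟ᵂ_ {suc n} = ≡-dec _≟ᵂ_ (≡-dec Fin._≟_ Fin._≟_)

  block : ∀ s {r} → (Fin t → W (s + r) ↔ W (s + r)) → Fin t → W (s + r) → W r
  block s σ i w = ancestor s (Inverse.to (σ i) w)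

  module _ (ρ : Column ↔ Column) (ρ-free : ∀ c → Inverse.to ρ c ≢ c) (s : ℕ) where

    -- All new height goes into `r`. As `s` is unchanged, covers can be iterated with blocks of
    -- fixed height.
    acyclic-suc : ∀ {L r} (σ : Fin t → W (s + r) ↔ W (s + r)) → Acyclic (block s σ) L →
      ∃[ r′ ] Σ[ σ′ ∈ (Fin t → W (s + r′) ↔ W (s + r′)) ] Acyclic (block s σ′) (suc L)
    acyclic-suc {L} {r} σ acyclic = E + r , σ̃ , acyclic-cover acyclic
      where
      E : ℕ
      -- One new column for each pair of a position and a tower.
      E = m t k (suc (s + r)) * t

      x : W (s + r) → Fin t → Fin E
      x w i = combine (φ (s + r) w) i

      x-injective : ∀ {p q i j} → x p i ≡ x q j → p ≡ q × i ≡ j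
      x-injective {p} {q} {i} {j} e =
        let e₁ , e₂ = Fin.combine-injective (φ (s + r) p) i (φ (s + r) q) j e
        in IsOrderIsomorphism.injective (φ-isOrderIsomorphism (s + r)) e₁ , e₂

      σ̃ : Fin t → W (s + (E + r)) ↔ W (s + (E + r))
      σ̃ i = insertion s E ↔-∘ (twist x ρ σ i ↔-∘ ↔-sym (insertion s E))

      extract-block : ∀ i p → let w , v = extract s E p in
        extract zero E (block s σ̃ i p) ≡
        (block s σ i w , updateAt v (x w i) (Inverse.to ρ))
      extract-block i p = trans (extract-ancestor s E (Inverse.to (σ̃ i) p))
        (cong (λ (w , v) → ancestor s w , v)
          (extract-insert s E (Inverse.to (twist x ρ σ i) (extract s E p))))

      extract-≡ : ∀ {i p q} → block s σ̃ i p ≡ block s σ̃ i q → _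
      extract-≡ {i} {p} {q} e = ,-injective
        (trans (sym (extract-block i p)) (trans (cong (extract zero E) e) (extract-block i q)))

      open Cover {c = block s σ} {c̃ = block s σ̃} _≟ᵂ_ x x-injective ρ ρ-free
        (λ p → proj₁ (extract s E p)) (λ p → proj₂ (extract s E p))
        (λ e f → ↔-injective (↔-sym (insertion s E)) (cong₂ _,_ e f))
        (λ e → proj₁ (extract-≡ e)) (λ e → proj₂ (extract-≡ e))

    ∃-acyclic : ∀ L →
      ∃[ r ] Σ[ σ ∈ (Fin t → W (s + r) ↔ W (s + r)) ] Acyclic (block s σ) L
    ∃-acyclic zero    = 0 , (λ _ → ↔-id _) , λ { z≤n () }
    ∃-acyclic (suc L) = let r , σ , acyclic = ∃-acyclic L in acyclic-suc σ acyclic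

-- Circuits and cut vertices

-- The steps of a circuit are data: in a glued graph they determine its colours.

record Circuit (G : Graph) (h : ℕ) : Set where
  open Graph G using (Vertex; Adj) renaming (_≈_ to _≃_)
  field
    {{nonZero}} : NonZero h
    vertex      : Fin h → Vertex
    injective   : Injective _≡_ _≃_ vertex
    step        : ∀ i → Adj (vertex i) (vertex (suc (toℕ i) mod h))

module _ {h : ℕ} {{_ : NonZero h}} where

  toℕ-mod : ∀ j → toℕ (j mod h) ≡ j % h
  toℕ-mod j = Fin.toℕ-fromℕ< (m%n<n j h)

  mod-cong : ∀ {i j} → i % h ≡ j % h → i mod h ≡ j mod h
  mod-cong {i} {j} e = Fin.toℕ-injective (trans (toℕ-mod i) (trans e (sym (toℕ-mod j))))

  mod-toℕ : ∀ (i : Fin h) → toℕ i mod h ≡ i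
  mod-toℕ i = Fin.toℕ-injective (trans (toℕ-mod (toℕ i)) (m<n⇒m%n≡m (Fin.toℕ<n i)))

  mod-suc : ∀ j → suc (toℕ (j mod h)) mod h ≡ suc j mod h
  mod-suc j = mod-cong (begin
    suc (toℕ (j mod h)) % h     ≡⟨ cong (λ i → suc i % h) (toℕ-mod j) ⟩
    suc (j % h) % h             ≡⟨ %-distribˡ-+ 1 (j % h) h ⟩
    (1 % h + j % h % h) % h     ≡⟨ cong (λ i → (1 % h + i) % h) (m%n%n≡m%n j h) ⟩
    (1 % h + j % h) % h         ≡⟨ %-distribˡ-+ 1 j h ⟨
    suc j % h                   ∎)
    where open ≡-Reasoning

  mod-period : ∀ j → (h + j) mod h ≡ j mod h
  mod-period j = mod-cong (trans (cong (_% h) (ℕ.+-comm h j)) ([m+n]%n≡m%n j h))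

  +-cancelʳ-% : ∀ d e o → (d + o) % h ≡ (e + o) % h → d % h ≡ e % h
  +-cancelʳ-% d e o eq = begin
    d % h                         ≡⟨ wrap d ⟨
    (d + o + c) % h               ≡⟨ %-distribˡ-+ (d + o) c h ⟩
    ((d + o) % h + c % h) % h     ≡⟨ cong (λ i → (i + c % h) % h) eq ⟩
    ((e + o) % h + c % h) % h     ≡⟨ %-distribˡ-+ (e + o) c h ⟨
    (e + o + c) % h               ≡⟨ wrap e ⟩
    e % h                         ∎
    where
    open ≡-Reasoning
    c : ℕ
    -- `o + c` equals `h * o`, so adding `c` removes `o` modulo `h`.
    c = pred h * o
    wrap : ∀ d → (d + o + c) % h ≡ d % h
    wrap d = begin
      (d + o + c) % h               ≡⟨ cong (_% h) (ℕ.+-assoc d o c) ⟩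
      (d + suc (pred h) * o) % h    ≡⟨ cong (λ n → (d + n * o) % h) (ℕ.suc-pred h) ⟩
      (d + h * o) % h               ≡⟨ cong (λ n → (d + n) % h) (ℕ.*-comm h o) ⟩
      (d + o * h) % h               ≡⟨ [m+kn]%n≡m%n d o h ⟩
      d % h                         ∎

  mod-distinct : ∀ o {d e} → d < e → e < h → (d + o) mod h ≢ (e + o) mod h
  mod-distinct o {d} {e} d<e e<h eq = ℕ.<⇒≢ d<e (begin
    d         ≡⟨ m<n⇒m%n≡m (ℕ.<-trans d<e e<h) ⟨
    d % h     ≡⟨ +-cancelʳ-% d e o eq-% ⟩
    e % h     ≡⟨ m<n⇒m%n≡m e<h ⟩
    e         ∎)
    where
    open ≡-Reasoning
    eq-% : (d + o) % h ≡ (e + o) % h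
    eq-% = trans (sym (toℕ-mod (d + o))) (trans (cong toℕ eq) (toℕ-mod (e + o)))

cycle⇒circuit : ∀ {G h} → Cycle G h → Circuit G h
cycle⇒circuit {G} {suc h} C = record
  { vertex    = vertex
  ; injective = injective
  ; step      = step′
  }
  where
  open Cycle C
  step′ : ∀ i → Graph.Adj G (vertex i) (vertex (suc (toℕ i) mod suc h))
  step′ i with ℕ.m≤n⇒m<n∨m≡n (Fin.toℕ<n i)
  ... | inj₁ 1+i<h = step i _ (trans (toℕ-mod (suc (toℕ i))) (m<n⇒m%n≡m 1+i<h))
  ... | inj₂ 1+i≡h = close i _ 1+i≡h
    (trans (toℕ-mod (suc (toℕ i))) (trans (cong (_% suc h) 1+i≡h) (n%n≡0 (suc h))))

module Around {G : Graph} {h : ℕ} (C : Circuit G h) where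
  open Graph G renaming (_≈_ to _≃_)
  open Circuit C

  at : ℕ → Vertex
  at j = vertex (j mod h)

  at-adj : ∀ j → Adj (at j) (at (suc j))
  at-adj j = subst (λ i → Adj (at j) (vertex i)) (mod-suc j) (step (j mod h))

  at-period : ∀ j → at (h + j) ≡ at j
  at-period j = cong vertex (mod-period j)

  at-distinct : ∀ o {d e} → d < e → e < h → ¬ at (d + o) ≃ at (e + o)
  at-distinct o d<e e<h v≈w = mod-distinct o d<e e<h (injective v≈w)

  length-bound : ∀ {N} (ρ : Fin N → Vertex) o →
                 (∀ d → d < h → ∃ λ i → at (d + o) ≃ ρ i) → h ≤ N
  length-bound ρ o covered = Fin.injective⇒≤ {f = λ i → proj₁ (cover i)} distinct
    where
    cover : ∀ (i : Fin h) → ∃ λ j → at (toℕ i + o) ≃ ρ j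
    cover i = covered (toℕ i) (Fin.toℕ<n i)
    agree : ∀ {i j} → proj₁ (cover i) ≡ proj₁ (cover j) → at (toℕ i + o) ≃ at (toℕ j + o)
    agree {i} {j} e = ≈.trans (proj₂ (cover i))
      (subst (λ z → ρ z ≃ at (toℕ j + o)) (sym e) (≈.sym (proj₂ (cover j))))
    distinct : ∀ {i j} → proj₁ (cover i) ≡ proj₁ (cover j) → i ≡ j
    distinct {i} {j} e with Fin.<-cmp i j
    ... | tri≈ _ i≡j _ = i≡j
    ... | tri< i<j _ _ = contradiction (agree e) (at-distinct o i<j (Fin.toℕ<n j))
    ... | tri> _ _ j<i = contradiction (agree (sym e)) (at-distinct o j<i (Fin.toℕ<n i))

  -- The circuit meets the cut vertex c at most once, so any of its vertices is
  -- joined to at o by an arc that avoids c.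
  cut-vertex : ∀ {S : Vertex → Set} {c} →
               (∀ {x y} → S x → Adj x y → S y ⊎ y ≃ c) →
               ∀ o → S (at o) → ∀ d → d < h → S (at (d + o)) ⊎ at (d + o) ≃ c
  cut-vertex {S} {c} closed o s d d<h
    with forward d | backward (h ∸ d) (ℕ.m∸n+n≡m (ℕ.<⇒≤ d<h))
    where
    forward : ∀ d → S (at (d + o)) ⊎ ∃[ e ] e ≤ d × at (e + o) ≃ c
    forward zero = inj₁ s
    forward (suc d) with forward d
    ... | inj₂ (e , e≤d , e≈c) = inj₂ (e , ℕ.m≤n⇒m≤1+n e≤d , e≈c)
    ... | inj₁ s′ with closed s′ (at-adj (d + o))
    ...   | inj₁ s″  = inj₁ s″
    ...   | inj₂ ≈c = inj₂ (suc d , ℕ.≤-refl , ≈c)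

    backward : ∀ d {d′} → d + d′ ≡ h →
               S (at (d′ + o)) ⊎ ∃[ e ] d′ ≤ e × e < h × at (e + o) ≃ c
    backward zero refl = inj₁ (subst S (sym (at-period o)) s)
    backward (suc d) {d′} e with backward d (trans (ℕ.+-suc d d′) e)
    ... | inj₂ (f , d′<f , f<h , f≈c) = inj₂ (f , ℕ.<⇒≤ d′<f , f<h , f≈c)
    ... | inj₁ s′ with closed s′ (Adj-sym (at-adj (d′ + o)))
    ...   | inj₁ s″  = inj₁ s″
    ...   | inj₂ ≈c = inj₂ (d′ , ℕ.≤-refl , ℕ.≤-trans (s≤s (ℕ.m≤n+m d′ d)) (ℕ.≤-reflexive e) , ≈c)
  ... | inj₁ s′ | _ = inj₁ s′
  ... | inj₂ _  | inj₁ s′ = inj₁ s′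
  -- Both arcs meet `c`, at offsets `e ≤ d ≤ f < h`, so injectivity forces `e = d`.
  ... | inj₂ (e , e≤d , e≈c) | inj₂ (f , d≤f , f<h , f≈c) with ℕ.m≤n⇒m<n∨m≡n e≤d
  ...   | inj₂ refl = inj₂ e≈c
  ...   | inj₁ e<d  = contradiction (≈.trans e≈c (≈.sym f≈c))
      (at-distinct o (ℕ.<-≤-trans e<d d≤f) f<h)

-- Circuits in a single tower

module _ (t k : ℕ) where
  open Tower t k

  -- The leaf to which a top-level clique is attached separates it from the rest, so a circuit
  -- meeting this clique lies in the clique and that leaf. A circuit avoiding the top level lies in
  -- the previous tower.
  circuit-bound : ∀ n {h} → Circuit (tower n) h → h ≤ suc (k ∸ 1)
  circuit-bound zero C = length-bound (λ i → i) 0 (λ d _ → at (d + 0) , refl)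
    where open Around C
  circuit-bound (suc n) {h} C with Fin.any? (λ i → new? (Circuit.vertex C i))
    where
    New : Graph.Vertex (tower (suc n)) → Set
    New v = ∃ λ y → v ≡ inj₂ y
    new? : ∀ v → Dec (New v)
    new? (inj₁ _) = no λ ()
    new? (inj₂ y) = yes (y , refl)
  ... | yes (i , (w , (u , x)) , vᵢ≡) = length-bound clique o covered
    where
    open Graph (tower (suc n)) using (Adj; module ≈) renaming (_≈_ to _≃_)
    open Circuit C using (vertex; nonZero)
    open Around C
    o = toℕ i

    clique : Fin (suc (k ∸ 1)) → Graph.Vertex (tower (suc n))
    clique zero    = inj₁ (leaf n w)
    clique (suc z) = inj₂ (w , (u , z))

    InClique : Graph.Vertex (tower (suc n)) → Set
    InClique v = ∃ λ z → v ≃ clique (suc z)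

    closed : ∀ {v v′} → InClique v → Adj v v′ → InClique v′ ⊎ v′ ≃ clique zero
    closed {inj₂ _} {inj₁ y} (z , inj₂ (refl , _)) a = inj₂ (inj₁ a)
    closed {inj₂ _} {inj₂ (_ , (_ , z′))} (z , inj₂ (refl , (refl , _))) (refl , (refl , _)) =
      inj₁ (z′ , ≈.refl)

    at-o : InClique (at o)
    at-o = x , ≈.reflexive (trans (cong vertex (mod-toℕ i)) vᵢ≡)

    covered : ∀ d → d < h → ∃ λ j → at (d + o) ≃ clique j
    covered d d<h with cut-vertex closed o at-o d d<h
    ... | inj₁ (z , e) = suc z , e
    ... | inj₂ e       = zero , e
  ... | no ¬new = circuit-bound n record
    { vertex    = λ i → proj₁ (old i)
    ; injective = λ {i} {j} e → C.injective (≈.trans (≈.reflexive (proj₂ (old i)))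
        (≈.trans (inj₁ e) (≈.reflexive (sym (proj₂ (old j))))))
    ; step      = λ i → subst₂ Adj (proj₂ (old i)) (proj₂ (old _)) (C.step i)
    }
    where
    open Graph (tower (suc n)) using (Adj; module ≈)
    module C = Circuit C
    open C using (nonZero)

    old : ∀ i → ∃ λ v → C.vertex i ≡ inj₁ v
    old i with C.vertex i in e
    ... | inj₁ v = v , refl
    ... | inj₂ y = contradiction (i , y , e) ¬new

-- Depth and subtrees

module Levels (t k : ℕ) where
  open Tower t k
  open Blocks t k

  module _ (n : ℕ) where
    open Graph (tower n) public using () renaming (Vertex to V; _≈_ to Same; Adj to Edge)

  depth : ∀ n → V n → ℕ
  depth zero    zero     = 0
  depth zero    (suc _)  = 1
  depth (suc n) (inj₁ v) = depth n v
  depth (suc n) (inj₂ _) = 2 + n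

  depth-root : ∀ n → depth n (root n) ≡ 0
  depth-root zero    = refl
  depth-root (suc n) = depth-root n

  depth-leaf : ∀ n w → depth n (leaf n w) ≡ suc n
  depth-leaf zero    w = refl
  depth-leaf (suc n) w = refl

  depth-cong : ∀ n {u v} → Same n u v → depth n u ≡ depth n v
  depth-cong zero    refl             = refl
  depth-cong (suc n) (inj₁ e)         = depth-cong n e
  depth-cong (suc n) (inj₂ (refl , _)) = refl

  depth-adj : ∀ n {u v} → Edge n u v → depth n u ≤ suc (depth n v)
  depth-adj zero    {zero}   a  = z≤n
  depth-adj zero    {suc _}  a  = s≤s z≤n
  depth-adj (suc n) {inj₁ u} {inj₁ v} a = depth-adj n a
  depth-adj (suc n) {inj₁ u} {inj₂ (w , _)} a = begin
    depth n u             ≡⟨ trans (depth-cong n a) (depth-leaf n w) ⟩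
    suc n                 ≤⟨ ℕ.m≤n+m (suc n) 2 ⟩
    3 + n                 ∎
    where open ℕ.≤-Reasoning
  depth-adj (suc n) {inj₂ (w , _)} {inj₁ v} a =
    ℕ.≤-reflexive (cong suc (sym (trans (depth-cong n a) (depth-leaf n w))))
  depth-adj (suc n) {inj₂ _} {inj₂ _} a = ℕ.n≤1+n _

  -- nothing for the root and for the vertices of W 0, …, W r.
  base : ∀ s {r} → V (s + r) → Maybe (W r)
  base zero    _              = nothing
  base (suc s) (inj₁ v)       = base s v
  base (suc s) (inj₂ (w , _)) = just (ancestor s w)

  base-cong : ∀ s {r} {u v} → Same (s + r) u v → base s {r} u ≡ base s {r} v
  base-cong zero    e                 = refl
  base-cong (suc s) (inj₁ e)          = base-cong s e
  base-cong (suc s) (inj₂ (refl , _)) = refl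

  base-leaf : ∀ s {r} {u} {w : W (s + r)} → Same (s + r) u (leaf (s + r) w) →
              suc r < depth (s + r) u → base s {r} u ≡ just (ancestor s w)
  base-leaf zero    {r} {w = w} e deep =
    contradiction (subst (suc r <_) (trans (depth-cong r e) (depth-leaf r w)) deep)
      (ℕ.<-irrefl refl)
  base-leaf (suc s) e deep = base-cong (suc s) e

  -- An edge can leave a subtree only through level `r`, whose depth is `suc r` because of the index
  -- shift.
  base-adj : ∀ s {r} {u v} → Edge (s + r) u v →
             suc r < depth (s + r) u → suc r < depth (s + r) v →
             base s {r} u ≡ base s {r} v
  base-adj zero    a _ _ = refl
  base-adj (suc s) {u = inj₁ _} {inj₁ _} a du dv = base-adj s a du dv
  base-adj (suc s) {u = inj₁ _} {inj₂ _} a du dv = base-leaf s a du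
  base-adj (suc s) {u = inj₂ _} {inj₁ _} a du dv = sym (base-leaf s a dv)
  base-adj (suc s) {u = inj₂ _} {inj₂ _} (refl , _) du dv = refl

-- Short circuits in the glued graph

module Glue (t k s r : ℕ) (σ : Fin t → Tower.W t k (s + r) ↔ Tower.W t k (s + r)) where
  open Tower t k
  open Blocks t k
  open Levels t k

  n : ℕ
  n = s + r

  Π : Fin t → Permutation′ (m t k (suc n))
  Π i = positions n ↔-∘ (σ i ↔-∘ ↔-sym (positions n))

  open Gluing n Π
  module ∼ = IsEquivalence ∼-isEquivalence
  module T = Graph (tower n)

  c : Fin t → W n → W r
  c = block s σ

  position : Fin (m t k (suc n)) → W n
  position = Inverse.from (positions n)

  position-injective : ∀ {i j} → position i ≡ position j → i ≡ j
  position-injective = ↔-injective (↔-sym (positions n))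

  -- The copy of x in the i-th tower belongs to the class that step (v) of the
  -- construction makes of j.
  LeafAt : Fin t → T.Vertex → Fin (m t k (suc n)) → Set
  LeafAt i x j = ∃ λ w → x T.≈ leaf n w × φ n w ≡ Π i ⟨$⟩ʳ j

  leafAt-∼ : ∀ {i i′ x x′ j} → LeafAt i x j → LeafAt i′ x′ j → (i , x) ∼ (i′ , x′)
  leafAt-∼ {j = j} (_ , p , q) (_ , p′ , q′) = leaves j p q p′ q′

  leafAt-depth : ∀ {i x j} → LeafAt i x j → depth n x ≡ suc n
  leafAt-depth (w , x≈w , _) = trans (depth-cong n x≈w) (depth-leaf n w)

  -- In tower `i`, class `j` occupies the leaf that `σ i` assigns to `position j`; the ancestor of
  -- this leaf is the block. This translates paths inside a tower into steps of a `Walk`.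
  leafAt-base : ∀ {i x j} → 0 < s → LeafAt i x j → base s x ≡ just (c i (position j))
  leafAt-base {i} {x} {j} 0<s l@(w , x≈w , e) =
    trans (base-leaf s x≈w (subst (suc r <_) (sym (leafAt-depth l)) (s≤s (ℕ.m<n+m r 0<s))))
          (cong (λ w → just (ancestor s w)) (↔-injective (positions n) e))

  same-copy : ∀ {i i′ x y} → i ≡ i′ → (i , x) ∼ (i′ , y) → x T.≈ y
  same-copy refl (same (_ , e)) = e
  same-copy refl (roots p q)    = T.≈.trans p (T.≈.sym q)
  same-copy refl (leaves j p q p′ q′) with refl ← ↔-injective (positions n) (trans q (sym q′)) =
    T.≈.trans p (T.≈.sym p′)

  other-copy : ∀ {i i′ x y} → i ≢ i′ → (i , x) ∼ (i′ , y) →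
               x T.≈ root n ⊎ ∃ λ j → LeafAt i x j × LeafAt i′ y j
  other-copy i≢i′ (same (e , _))         = contradiction e i≢i′
  other-copy i≢i′ (roots p _)            = inj₁ p
  other-copy i≢i′ (leaves j p q p′ q′) = inj₂ (j , (_ , p , q) , (_ , p′ , q′))

  depth-∼ : ∀ {i i′ x y} → (i , x) ∼ (i′ , y) → depth n x ≡ depth n y
  depth-∼ (same (_ , e))       = depth-cong n e
  depth-∼ (roots p q)          = trans (depth-cong n p) (sym (depth-cong n q))
  depth-∼ {i} {i′} {x} {y} (leaves j p q p′ q′) =
    trans (leafAt-depth {i} {x} {j} (_ , p , q)) (sym (leafAt-depth {i′} {y} {j} (_ , p′ , q′)))

  module ShortCircuit {h L : ℕ} (h<s : h < s) (acyclic : Acyclic c L) (h≤L : h ≤ L)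
                      (C : Circuit glued h) where
    open Circuit C
    open Around C

    next : Fin h → Fin h
    next i = suc (toℕ i) mod h

    -- `colour` is the tower containing the edge from vertex `i` to the next; `start` and `finish`
    -- represent its ends there.
    module Step (i : Fin h) where
      colour : Fin t
      colour = proj₁ (proj₁ (step i))

      start finish : T.Vertex
      start  = proj₂ (proj₁ (step i))
      finish = proj₂ (proj₁ (proj₂ (step i)))

      start∼ : vertex i ∼ (colour , start)
      start∼ = proj₁ (proj₂ (proj₂ (step i)))

      finish∼ : vertex (next i) ∼ (colour , finish)
      finish∼ = ∼.trans (proj₁ (proj₂ (proj₂ (proj₂ (step i)))))
        (same (sym (proj₁ (proj₂ (proj₂ (proj₂ (proj₂ (step i)))))) , T.≈.refl))

      adj : T.Adj start finish
      adj = proj₂ (proj₂ (proj₂ (proj₂ (proj₂ (step i)))))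

    open Step

    -- Within one tower gluing identifies nothing, so each `finish` is the next `start` and the
    -- circuit lifts to the tower.
    monochromatic-bound : (∀ i → colour i ≡ colour (next i)) → h ≤ suc (k ∸ 1)
    monochromatic-bound same-next = circuit-bound t k n record
      { vertex    = start
      ; injective = λ {i} {j} e → injective (∼.trans (start∼ i)
          (∼.trans (same (trans (constant i) (sym (constant j)) , e)) (∼.sym (start∼ j))))
      ; step      = λ i → proj₁ T.Adj-resp
          (same-copy (same-next i) (∼.trans (∼.sym (finish∼ i)) (start∼ (next i)))) (adj i)
      }
      where
      constant-at : ∀ j → colour (j mod h) ≡ colour (0 mod h)
      constant-at zero    = refl
      constant-at (suc j) = trans (cong colour (sym (mod-suc j)))
        (trans (sym (same-next (j mod h))) (constant-at j))
      constant : ∀ i → colour i ≡ colour (0 mod h)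
      constant i = trans (cong colour (sym (mod-toℕ i))) (constant-at (toℕ i))

    -- Edges are now indexed modulo `h`. The vertex `at (suc j)` is represented by `β j` in the
    -- tower of the edge before it and by `α (suc j)` in that of the edge after it.
    κ : ℕ → Fin t
    κ j = colour (j mod h)

    α β : ℕ → T.Vertex
    α j = start (j mod h)
    β j = finish (j mod h)

    at∼α : ∀ j → at j ∼ (κ j , α j)
    at∼α j = start∼ (j mod h)

    at∼β : ∀ j → at (suc j) ∼ (κ j , β j)
    at∼β j = subst (λ i → vertex i ∼ (κ j , β j)) (mod-suc j) (finish∼ (j mod h))

    β∼α : ∀ j → (κ j , β j) ∼ (κ (suc j) , α (suc j))
    β∼α j = ∼.trans (∼.sym (at∼β j)) (at∼α (suc j))

    -- Only vertices of equal depth are glued, so any representative gives the same value.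
    height : ℕ → ℕ
    height j = depth n (proj₂ (at j))

    height-α : ∀ j → height j ≡ depth n (α j)
    height-α j = depth-∼ (at∼α j)

    height-β : ∀ j → height (suc j) ≡ depth n (β j)
    height-β j = depth-∼ (at∼β j)

    height-≤ : ∀ o d → height o ≤ d + height (d + o)
    height-≤ o zero    = ℕ.≤-refl
    height-≤ o (suc d) = begin
      height o                        ≤⟨ height-≤ o d ⟩
      d + height (d + o)              ≡⟨ cong (d +_) (height-α (d + o)) ⟩
      d + depth n (α (d + o))         ≤⟨ ℕ.+-monoʳ-≤ d (depth-adj n (adj _)) ⟩
      d + suc (depth n (β (d + o)))   ≡⟨ cong (λ x → d + suc x) (height-β (d + o)) ⟨
      d + suc (height (suc d + o))    ≡⟨ ℕ.+-suc d _ ⟩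
      suc d + height (suc d + o)      ∎
      where open ℕ.≤-Reasoning

    height-≥ : ∀ o d → height (d + o) ≤ d + height o
    height-≥ o zero    = ℕ.≤-refl
    height-≥ o (suc d) = begin
      height (suc d + o)              ≡⟨ height-β (d + o) ⟩
      depth n (β (d + o))             ≤⟨ depth-adj n (T.Adj-sym (adj _)) ⟩
      suc (depth n (α (d + o)))       ≡⟨ cong suc (height-α (d + o)) ⟨
      suc (height (d + o))            ≤⟨ s≤s (height-≥ o d) ⟩
      suc d + height o                ∎
      where open ℕ.≤-Reasoning

    Leaf : Fin t × T.Vertex → Fin (m t k (suc n)) → Set
    Leaf v j = ∃ λ i → ∃ λ x → v ∼ (i , x) × LeafAt i x j

    leaf-unique : ∀ {v v′ j} → Leaf v j → Leaf v′ j → v ∼ v′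
    leaf-unique (_ , _ , v∼ , l) (_ , _ , v′∼ , l′) =
      ∼.trans v∼ (∼.trans (leafAt-∼ l l′) (∼.sym v′∼))

    h≤n : h ≤ n
    h≤n = ℕ.≤-trans (ℕ.<⇒≤ h<s) (ℕ.m≤m+n s r)

    κ-period : ∀ j → κ (h + j) ≡ κ j
    κ-period j = cong colour (mod-period j)

    β-period : ∀ j → β (h + j) ≡ β j
    β-period j = cong finish (mod-period j)

    last : ℕ
    last = pred h

    last<h : last < h
    last<h = ℕ.≤-reflexive (ℕ.suc-pred h)

    last-+ : ∀ j → last + suc j ≡ h + j
    last-+ j = trans (ℕ.+-suc last j) (cong (_+ j) (ℕ.suc-pred h))

    -- Starting at the root, the circuit is too short to reach a leaf and does not revisit the root
    -- before closing, so the tower never changes up to edge `last + o`, which is edge `j₀` again.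
    no-change-at-root : ∀ j₀ → β j₀ T.≈ root n → κ j₀ ≡ κ (suc j₀)
    no-change-at-root j₀ root₀ = trans (sym (κ-period j₀))
      (trans (cong κ (sym (last-+ j₀))) (constant last last<h))
      where
      o = suc j₀

      height-o : height o ≡ 0
      height-o = trans (height-β j₀) (trans (depth-cong n root₀) (depth-root n))

      constant : ∀ d → d < h → κ (d + o) ≡ κ o
      constant zero    _ = refl
      constant (suc d) 1+d<h with κ (d + o) Fin.≟ κ (suc d + o)
      ... | yes e = trans (sym e) (constant d (ℕ.<⇒≤ 1+d<h))
      ... | no κ≢ with other-copy κ≢ (β∼α (d + o))
      ...   | inj₁ root′ = contradiction
        (∼.trans (at∼β j₀) (∼.trans (roots root₀ root′) (∼.sym (at∼β (d + o)))))
        (at-distinct o (s≤s z≤n) 1+d<h)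
      ...   | inj₂ (j , l , _) = contradiction (begin-strict
        n                    <⟨ ℕ.n<1+n n ⟩
        suc n                ≡⟨ leafAt-depth l ⟨
        depth n (β (d + o))  ≡⟨ height-β (d + o) ⟨
        height (suc d + o)   ≤⟨ height-≥ o (suc d) ⟩
        suc d + height o     ≡⟨ cong (suc d +_) height-o ⟩
        suc d + 0            ≡⟨ ℕ.+-identityʳ (suc d) ⟩
        suc d                <⟨ 1+d<h ⟩
        h                    ≤⟨ h≤n ⟩
        n                    ∎) (ℕ.<-irrefl refl)
        where open ℕ.≤-Reasoning

    module FromLeaf (j₀ : ℕ) (p₀ : Fin (m t k (suc n))) (κ≢ : κ j₀ ≢ κ (suc j₀))
                    (l₀ : LeafAt (κ j₀) (β j₀) p₀) (l₁ : LeafAt (κ (suc j₀)) (α (suc j₀)) p₀) where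
      o = suc j₀

      0<s : 0 < s
      0<s = ℕ.≤-<-trans z≤n h<s

      -- The walk around starts at a leaf, of depth `s + r + 1`, and `d < s` steps cannot climb to
      -- level `r`.
      deep : ∀ {d} → d ≤ h → suc r < height (d + o)
      deep {d} d≤h = ℕ.+-cancelˡ-< d _ _ (begin-strict
        d + suc r            <⟨ ℕ.+-monoˡ-< (suc r) (ℕ.≤-<-trans d≤h h<s) ⟩
        s + suc r            ≡⟨ ℕ.+-suc s r ⟩
        suc n                ≡⟨ trans (height-β j₀) (leafAt-depth l₀) ⟨
        height o             ≤⟨ height-≤ o d ⟩
        d + height (d + o)   ∎)
        where open ℕ.≤-Reasoning

      base-edge : ∀ {d} → d < h → base s (α (d + o)) ≡ base s (β (d + o))
      base-edge {d} d<h = base-adj s (adj _)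
        (subst (suc r <_) (height-α (d + o)) (deep (ℕ.<⇒≤ d<h)))
        (subst (suc r <_) (height-β (d + o)) (deep d<h))

      -- Either the tower has not changed since `o`, or the leaves where it changed form a walk from
      -- `p₀` to `p` whose last tower is not the current one, ready for `snoc`.
      Trail : ℕ → ℕ → Fin (m t k (suc n)) → Set
      Trail d e p =
        (e ≡ 0 × p ≡ p₀ × κ (d + o) ≡ κ o) ⊎
        (0 < e × ∃[ l ] ∃[ i ] l ≤ d × i ≢ κ (d + o) × Walk c (position p₀) l i (position p))

      -- At the edge d + o, the last change of colour took place at the vertex e + o.
      record Scan (d : ℕ) : Set where
        field
          e     : ℕ
          e≤d   : e ≤ d
          p     : Fin (m t k (suc n))
          leafₑ : Leaf (at (e + o)) p
          trail : Trail d e p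
          baseₑ : base s (β (d + o)) ≡ just (c (κ (d + o)) (position p))

        -- Since `p` the circuit has stayed in one subtree of the current tower, so a leaf `p′`
        -- reached there shares its block. When the circuit closes, `p′` is `p₀`; the case without
        -- earlier changes is then excluded by colours, hence the premise on `κ`.
        extend : ∀ {p′} → (κ (d + o) ≡ κ o → p ≡ p₀ → p′ ≢ p₀) → (0 < e → p ≢ p′) →
                 LeafAt (κ (d + o)) (β (d + o)) p′ →
                 ∃[ l ] l ≤ suc d × Walk c (position p₀) l (κ (d + o)) (position p′)
        extend {p′} p′≢p₀ p≢p′ l 
          with same-block ← just-injective (trans (sym baseₑ) (leafAt-base 0<s l))
          with trail
        ... | inj₁ (_ , p≡p₀ , κ≡) =
          1 , s≤s z≤n , first (λ e → p′≢p₀ κ≡ p≡p₀ (sym (position-injective e)))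
            (trans (cong (λ q → c (κ (d + o)) (position q)) (sym p≡p₀)) same-block)
        ... | inj₂ (0<e , l′ , i , l′≤d , i≢ , w) =
          suc l′ , s≤s l′≤d , snoc w i≢ (λ e → p≢p′ 0<e (position-injective e)) same-block

      leaf-o : Leaf (at o) p₀
      leaf-o = _ , _ , at∼β j₀ , l₀

      scan : ∀ d → d < h → Scan d
      scan zero 0<h = record
        { e = 0 ; e≤d = z≤n ; p = p₀ ; leafₑ = leaf-o
        ; trail = inj₁ (refl , refl , refl)
        ; baseₑ = trans (sym (base-edge 0<h)) (leafAt-base 0<s l₁)
        }
      scan (suc d) 1+d<h with scan d (ℕ.<⇒≤ 1+d<h) | κ (d + o) Fin.≟ κ (suc d + o)
      ... | S | yes κ≡ = record
        { Scan S
        ; e≤d   = ℕ.m≤n⇒m≤1+n (Scan.e≤d S)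
        ; trail = trail′ (Scan.trail S)
        ; baseₑ = trans (sym (base-edge 1+d<h))
            (trans (sym (base-cong s (same-copy κ≡ (β∼α (d + o)))))
              (trans (Scan.baseₑ S) (cong (λ i → just (c i (position (Scan.p S)))) κ≡)))
        }
        where
        trail′ : ∀ {e p} → Trail d e p → Trail (suc d) e p
        trail′ (inj₁ (e≡0 , p≡p₀ , κ≡₀)) = inj₁ (e≡0 , p≡p₀ , trans (sym κ≡) κ≡₀)
        trail′ (inj₂ (0<e , l , i , l≤d , i≢ , w)) =
          inj₂ (0<e , l , i , ℕ.m≤n⇒m≤1+n l≤d , (λ i≡ → i≢ (trans i≡ (sym κ≡))) , w)
      ... | S | no κ≢′ with other-copy κ≢′ (β∼α (d + o))
      ...   | inj₁ root′ = contradiction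
        (subst (suc r <_)
          (trans (height-β (d + o)) (trans (depth-cong n root′) (depth-root n)))
          (deep {suc d} (ℕ.<⇒≤ 1+d<h)))
        λ ()
      ...   | inj₂ (p′ , l , l′) = record
        { e = suc d ; e≤d = ℕ.≤-refl ; p = p′ ; leafₑ = leaf′
        ; trail = inj₂ (s≤s z≤n , _ , _ , proj₁ (proj₂ w) , κ≢′ , proj₂ (proj₂ w))
        ; baseₑ = trans (sym (base-edge 1+d<h)) (leafAt-base 0<s l′)
        }
        where
        open Scan S
        leaf′ : Leaf (at (suc d + o)) p′
        leaf′ = _ , _ , at∼β (d + o) , l
        p≢p′ : p ≢ p′
        p≢p′ p≡p′ = at-distinct o (s≤s e≤d) 1+d<h
          (leaf-unique leafₑ (subst (Leaf (at (suc d + o))) (sym p≡p′) leaf′))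
        w = extend (λ _ p≡p₀ p′≡p₀ → p≢p′ (trans p≡p₀ (sym p′≡p₀))) (λ _ → p≢p′) l

      -- A full turn arrives at `p₀` again along edge `j₀`, whose colour differs from that of edge
      -- `o`. So the tower has changed in between, and the walk closes after at most `h` steps.
      impossible : ∀ {A : Set} → A
      impossible = contradiction (proj₂ (proj₂ w))
        (acyclic (ℕ.≤-trans (proj₁ (proj₂ w)) (ℕ.≤-trans last<h h≤L)))
        where
        S = scan last last<h
        open Scan S
        κ-last : κ (last + o) ≡ κ j₀
        κ-last = trans (cong κ (last-+ j₀)) (κ-period j₀)
        β-last : β (last + o) ≡ β j₀
        β-last = trans (cong β (last-+ j₀)) (β-period j₀)
        w = extend (λ κ≡ _ _ → κ≢ (trans (sym κ-last) κ≡))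
          (λ 0<e p≡p₀ → at-distinct o 0<e (ℕ.≤-<-trans e≤d last<h)
            (leaf-unique leaf-o (subst (Leaf (at (e + o))) p≡p₀ leafₑ)))
          (subst₂ (λ i x → LeafAt i x p₀) (sym κ-last) (sym β-last) l₀)

    short-circuit-bound : h ≤ suc (k ∸ 1)
    short-circuit-bound with Fin.all? (λ i → colour i Fin.≟ colour (next i))
    ... | yes same-next = monochromatic-bound same-next
    ... | no ¬same-next
      with i , κᵢ≢ ← Fin.¬∀⟶∃¬ h _ (λ i → colour i Fin.≟ colour (next i)) ¬same-next
      with κ≢ ← (λ e → κᵢ≢ (trans (cong colour (sym (mod-toℕ i))) e))
      with other-copy κ≢ (β∼α (toℕ i))
    ... | inj₁ root₀ = contradiction (no-change-at-root (toℕ i) root₀) κ≢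
    ... | inj₂ (p₀ , l₀ , l₁) = FromLeaf.impossible (toℕ i) p₀ κ≢ l₀ l₁

  -- If two towers had equal permutations, they would have equal blocks, and two positions of one
  -- block would give a closed walk of length 2: out by one tower, back by the other.
  Π-injective : ∀ {L} → 2 ≤ L → Acyclic c L →
                (w : W n) (w′ : W n) → w ≢ w′ → ancestor s w ≡ ancestor s w′ →
                Injective _≡_ _≈_ Π
  Π-injective 2≤L acyclic w w′ w≢w′ e {i} {j} Πᵢ≈Πⱼ with i Fin.≟ j
  ... | yes i≡j = i≡j
  ... | no i≢j  = contradiction
    (snoc (first p≢p′ sameᵢ) i≢j (≢-sym p≢p′) sameⱼ)
    (acyclic 2≤L)
    where
    p : W n → W n
    p = Inverse.from (σ i)
    at-p : ∀ w → c i (p w) ≡ ancestor s w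
    at-p w = cong (ancestor s) (Inverse.strictlyInverseˡ (σ i) w)
    p≢p′ : p w ≢ p w′
    p≢p′ e = w≢w′ (↔-injective (↔-sym (σ i)) e)
    agree : ∀ w → Inverse.to (σ i) w ≡ Inverse.to (σ j) w
    agree w = trans (cong (Inverse.to (σ i)) (sym (Inverse.strictlyInverseʳ (positions n) w)))
      (trans (↔-injective (positions n) (Πᵢ≈Πⱼ (φ n w)))
        (cong (Inverse.to (σ j)) (Inverse.strictlyInverseʳ (positions n) w)))
    c-agree : ∀ w → c i w ≡ c j w
    c-agree w = cong (ancestor s) (agree w)
    sameᵢ : c i (p w) ≡ c i (p w′)
    sameᵢ = trans (at-p w) (trans e (sym (at-p w′)))
    sameⱼ : c j (p w′) ≡ c j (p w)
    sameⱼ = trans (sym (c-agree (p w′))) (trans (sym sameᵢ) (c-agree (p w)))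

-- Choice of the parameters

derangement : ∀ {t k} → 3 ≤ t → Σ[ ρ ∈ (Blocks.Column t k ↔ Blocks.Column t k) ]
              ∀ a → Inverse.to ρ a ≢ a
derangement (s≤s (s≤s (s≤s _))) =
  -- For `k = 2` the second entry of a column has a single value, so the rotation acts on the first,
  -- which has at least two.
  (rotate ×-↔ ↔-id _) , λ (u , _) e → rotate-free u (cong proj₁ e)

column : ∀ {t k} → 3 ≤ t → 2 ≤ k → Blocks.Column t k
column (s≤s (s≤s (s≤s _))) (s≤s (s≤s _)) = zero , zero

labelling : ∀ {t k} → Blocks.Column t k → ∀ n → Tower.W t k n
labelling a zero    = proj₂ a
labelling a (suc n) = labelling a n , a

theorem11 : (t k g : ℕ) → 2 ≤ k → k < t → k < g →
    ∃[ q ] Σ[ q≥2 ∈ 2 ≤ q ] Σ[ Π ∈ (Fin t → Permutation′ (m t k q)) ]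
    (Injective _≡_ _≈_ Π ×
    ((h : ℕ) → k < h → h < g → ¬ Cycle (G t k q q≥2 Π) h))
theorem11 t k (suc g) 2≤k k<t k<g
  -- The outer `suc` undoes the index shift of `Tower`.
  = suc (suc g + r) , s≤s (s≤s z≤n) , Π , distinct , no-cycle
  where
  3≤t : 3 ≤ t
  3≤t = ℕ.≤-trans (s≤s 2≤k) k<t

  ρ = proj₁ (derangement {t} {k} 3≤t)
  ρ-free = proj₂ (derangement {t} {k} 3≤t)
  -- The bound on cycle lengths, here `suc g`, serves both as the height `s` of the blocks and as
  -- the bound `L` on walks.
  solution = Blocks.∃-acyclic t k ρ ρ-free (suc g) (suc g)
  r = proj₁ solution
  σ = proj₁ (proj₂ solution)
  acyclic = proj₂ (proj₂ solution)

  open Glue t k (suc g) r σ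

  a : Blocks.Column t k
  a = column 3≤t 2≤k

  distinct : Injective _≡_ _≈_ Π
  -- Labels differing only in the last column have a common ancestor, as `s` is positive.
  distinct = Π-injective (ℕ.≤-trans 2≤k (ℕ.<⇒≤ k<g)) acyclic
    (labelling a _ , Inverse.to ρ a) (labelling a _ , a) (λ e → ρ-free a (cong proj₂ e)) refl

  no-cycle : (h : ℕ) → k < h → h < suc g → ¬ Cycle (G t k (suc (suc g + r)) (s≤s (s≤s z≤n)) Π) h
  no-cycle h k<h h<g C = ℕ.<⇒≱ k<h (subst (h ≤_) (ℕ.m+[n∸m]≡n (ℕ.<⇒≤ 2≤k))
    (ShortCircuit.short-circuit-bound h<g acyclic (ℕ.<⇒≤ h<g) (cycle⇒circuit C)))
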